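{- Let $U$ be a countably infinite universe and let $\mathcal{C}=(L_1,L_2,\ldots)$ be a countable collection of languages over $U$. For every finite $n$, there exists an algorithm $\mathcal{A}$ that non-uniformly generates from $\mathcal{C}$, with generation times $t(L_1),t(L_2),\ldots$ (where $t(L_i)=t_{\mathcal{A}}(L_i)$), such that the following holds: every algorithm $\mathcal{G}$ with $t_{\mathcal{G}}(L_i)<t(L_i)$ for some $i\le n$ satisfies $t_{\mathcal{G}}(L_j)>t(L_j)$ for some other index $j\neq i$ with $j\le n$.
   Context: A language is an infinite subset of $U$. A collection $\mathcal{C}=(L_1,L_2,\ldots)$ is a sequence of languages; repetitions are allowed and entries are distinguished by their index. An enumeration of a language $L$ is a sequence $x_1,x_2,\ldots$ with $x_t\in L$ for all $t$ and such that every $x\in L$ equals $x_t$ for some finite $t$. A generating algorithm, at each time step $t\ge 1$, receives $x_1,\ldots,x_t$ and outputs a string $z_t\in U$. $S_t$ denotes the set of distinct strings among $x_1,\ldots,x_t$. An algorithm $\mathcal{G}$ non-uniformly generates from $\mathcal{C}$ if for every index $i$ there is a finite number $t(L_i)$ such that for every enumeration of $L_i$ presented to $\mathcal{G}$, $z_t\in L_i\setminus S_t$ for all $t$ with $|S_t|\ge t(L_i)$. The generation time $t_{\mathcal{G}}(L_i)$ of an algorithm $\mathcal{G}$ for $L_i$ is the least such number (and $\infty$ if none exists). -}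

module Defs where

open import Axiom.ExcludedMiddle using (ExcludedMiddle)
open import Data.List.Base using (List; length; deduplicate; applyUpTo)
open import Data.List.Membership.Propositional using () renaming (_∈_ to _∈ₗ_; _∉_ to _∉ₗ_)
open import Data.List.NonEmpty.Base using (List⁺; _∷_; toList)
open import Data.Nat.Base using (ℕ; suc; _≤_; _<_)
import Data.Nat.Properties as ℕ
open import Data.Product.Base using (∃; _×_; _,_)
open import Function.Base using (_∘_)
open import Function.Bundles using (_↔_)
open import Function.Properties.Inverse using (↔⇒↣)
open import Level using (0ℓ)
open import Relation.Binary.Definitions using (DecidableEquality)
open import Relation.Binary.PropositionalEquality.Core using (_≡_)
open import Relation.Nullary.Construct.Add.Supremum using (_⁺; ⊤⁺; [_])
open import Relation.Nullary.Decidable using (Dec; yes; no; via-injection)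
open import Relation.Nullary.Negation.Core using (¬_)
open import Relation.Unary using (Pred; _∈_; _⊆_)

-- ℕ extended by a top element ⊤⁺ = ∞, with its strict order.
open import Relation.Binary.Construct.Add.Supremum.Strict _<_ public using () renaming (_<⁺_ to _<∞_)

ℕ∞ : Set
ℕ∞ = ℕ ⁺

Least : Pred ℕ 0ℓ → Pred ℕ 0ℓ
Least P k = P k × (∀ m → P m → k ≤ m)

-- The theory is classical: em is what makes "the least number
-- such that …, and ∞ if there is none" a well-defined element of ℕ∞.
module Generation (em : ExcludedMiddle 0ℓ) {U : Set} (U↔ℕ : U ↔ ℕ) where

  _≟_ : DecidableEquality U
  _≟_ = via-injection (↔⇒↣ U↔ℕ) ℕ._≟_

  Finite : Pred U 0ℓ → Set
  Finite L = ∃ λ (xs : List U) → L ⊆ (_∈ₗ xs)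

  record Language : Set₁ where
    field
      members  : Pred U 0ℓ
      infinite : ¬ Finite members

  open Language public

  -- C 0, C 1, … are the languages L₁, L₂, …
  Collection : Set₁
  Collection = ℕ → Language

  -- x 0, x 1, … are the strings x₁, x₂, …
  IsEnumeration : Language → (ℕ → U) → Set
  IsEnumeration L x =
    (∀ t → x t ∈ members L) × (∀ {u} → u ∈ members L → ∃ λ t → x t ≡ u)

  -- The argument is the (never empty) input x₁, …, xₜ received so far;
  -- there is no computability requirement.
  Algorithm : Set
  Algorithm = List⁺ U → U

  -- x 0, …, x t: the input at time step t + 1, steps being counted from 1.
  prefix : (ℕ → U) → ℕ → List⁺ U
  prefix x t = x 0 ∷ applyUpTo (x ∘ suc) t

  distinct : List⁺ U → List U
  distinct xs = deduplicate _≟_ (toList xs)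

  -- k is an admissible choice of the number t(L) for G.
  GeneratesFrom : Algorithm → Language → Pred ℕ 0ℓ
  GeneratesFrom G L k =
    ∀ (x : ℕ → U) → IsEnumeration L x →
    ∀ t → let S = distinct (prefix x t)
              z = G (prefix x t)
          in k ≤ length S → z ∈ members L × z ∉ₗ S

  NonUniformlyGenerates : Algorithm → Collection → Set
  NonUniformlyGenerates G C = ∀ i → ∃ (GeneratesFrom G (C i))

  -- By well-ordering (and em) the no-case occurs only if no number is admissible.
  generationTime : Algorithm → Language → ℕ∞
  generationTime G L = choose em
    where
    choose : Dec (∃ (Least (GeneratesFrom G L))) → ℕ∞
    choose (yes (k , _)) = [ k ]
    choose (no _)        = ⊤⁺

{-# OPTIONS --safe #-}

-- Every finite sample from L extends to an enumeration of L, so a vector of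
-- times k is achievable on the first n languages iff for each sample S some
-- string outside S lies in all L_i with S ⊆ L_i and k_i ≤ |S|.  Such vectors
-- exist: once |S| exceeds every finite intersection of the first m languages,
-- the intersection of those containing S is infinite.  A feasible vector in ℕⁿ
-- with minimal sum is Pareto optimal, and giving the later languages times
-- beyond these intersection bounds extends it to the whole collection without
-- changing its first n entries.
module Submission where

open import Defs
open import Axiom.ExcludedMiddle using (ExcludedMiddle)
open import Axiom.DoubleNegationElimination using (em⇒dne)
open import Data.List.Base using (List; []; _∷_; length; filter; applyUpTo)
open import Data.List.Membership.Propositional using () renaming (_∈_ to _∈ₗ_; _∉_ to _∉ₗ_)
open import Data.List.Membership.Propositional.Properties using (∈-filter⁺; ∈-deduplicate⁻)
open import Data.List.NonEmpty.Base using (List⁺; _∷_; toList)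
open import Data.List.Properties using (filter-notAll)
open import Data.List.Relation.Unary.All as All using (All; []; _∷_)
import Data.List.Relation.Unary.All.Properties as All
open import Data.List.Relation.Unary.Any as Any using (here; there)
open import Data.List.Relation.Unary.Unique.Propositional using (Unique; []; _∷_)
import Data.List.Relation.Unary.Unique.DecPropositional.Properties as DecUnique
open import Data.Nat.Base using (ℕ; zero; suc; _+_; _⊔_; _≤_; _<_; z≤n; z<s; s≤s; s<s)
open import Data.Nat.Induction using (<-rec)
open import Data.Nat.ListAction using (sum)
import Data.Nat.Properties as ℕ
open import Data.Product.Base using (∃; _×_; _,_; proj₁; proj₂; map₂)
open import Data.Sum.Base using (inj₁; inj₂)
open import Data.Unit.Base using (⊤; tt)
open import Function.Base using (_∘_; case_of_)
open import Function.Bundles using (_↔_; Inverse)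
open import Level using (0ℓ)
open import Relation.Binary.Definitions using (DecidableEquality)
open import Relation.Binary.PropositionalEquality.Core using (_≡_; _≢_; refl; sym; trans; cong; subst)
open import Relation.Nullary.Construct.Add.Supremum using (⊤⁺; [_])
open import Relation.Nullary.Decidable using (yes; no; ¬?)
open import Relation.Nullary.Negation using (¬_; contradiction)
open import Relation.Unary using (Pred; _∈_; _∩_)

import Relation.Binary.Construct.Add.Supremum.Strict _<_ as ∞

-- Counting distinct elements and comparing finite sums.

unique-⊆⇒length≤ : ∀ {A : Set} → DecidableEquality A → {xs ys : List A} → Unique xs →
                   (∀ {u} → u ∈ₗ xs → u ∈ₗ ys) → length xs ≤ length ys
unique-⊆⇒length≤ _≟_ [] xs⊆ys = z≤n
unique-⊆⇒length≤ _≟_ {x ∷ xs} {ys} (x∉xs ∷ xs!) xs⊆ys = ℕ.≤-<-trans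
  (unique-⊆⇒length≤ _≟_ xs! λ u∈xs → ∈-filter⁺ ≢x? (xs⊆ys (there u∈xs)) (All.lookup x∉xs u∈xs))
  (filter-notAll ≢x? ys (Any.map (λ x≡y x≢y → x≢y x≡y) (xs⊆ys (here refl))))
  where
  ≢x? = λ y → ¬? (x ≟ y)

sum-mono-≤ : ∀ n {f g : ℕ → ℕ} → (∀ i → i < n → f i ≤ g i) →
             sum (applyUpTo f n) ≤ sum (applyUpTo g n)
sum-mono-≤ zero    f≤g = z≤n
sum-mono-≤ (suc n) f≤g =
  ℕ.+-mono-≤ (f≤g 0 z<s) (sum-mono-≤ n λ i i<n → f≤g (suc i) (s<s i<n))

sum-mono-< : ∀ n {f g : ℕ → ℕ} → (∀ i → i < n → f i ≤ g i) →
             ∀ {i} → i < n → f i < g i → sum (applyUpTo f n) < sum (applyUpTo g n)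
sum-mono-< (suc n) f≤g {zero}  _         fi<gi =
  ℕ.+-mono-<-≤ fi<gi (sum-mono-≤ n λ i i<n → f≤g (suc i) (s<s i<n))
sum-mono-< (suc n) f≤g {suc i} (s<s i<n) fi<gi =
  ℕ.+-mono-≤-< (f≤g 0 z<s) (sum-mono-< n (λ j j<n → f≤g (suc j) (s<s j<n)) i<n fi<gi)

-- Infinite sequences with a prescribed finite beginning.

infixr 5 _++ω_

_++ω_ : ∀ {A : Set} → List A → (ℕ → A) → ℕ → A
([]       ++ω f) t       = f t
((x ∷ xs) ++ω f) zero    = x
((x ∷ xs) ++ω f) (suc t) = (xs ++ω f) t

applyUpTo-++ω : ∀ {A : Set} (xs : List A) f → applyUpTo (xs ++ω f) (length xs) ≡ xs
applyUpTo-++ω []       f = refl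
applyUpTo-++ω (x ∷ xs) f = cong (x ∷_) (applyUpTo-++ω xs f)

++ω-all : ∀ {A : Set} {P : Pred A 0ℓ} {xs f} → All P xs → (∀ t → P (f t)) → ∀ t → P ((xs ++ω f) t)
++ω-all []         pf t       = pf t
++ω-all (px ∷ pxs) pf zero    = px
++ω-all (px ∷ pxs) pf (suc t) = ++ω-all pxs pf t

++ω-shift : ∀ {A : Set} (xs : List A) {f : ℕ → A} t → (xs ++ω f) (length xs + t) ≡ f t
++ω-shift []       t = refl
++ω-shift (x ∷ xs) t = ++ω-shift xs t

-- Well-ordering, finite samples and generation times.

module _ (em : ExcludedMiddle 0ℓ) where

  least : (P : Pred ℕ 0ℓ) → ∀ {k} → P k → ∃ (Least P)
  least P {k} = <-rec (λ k → P k → ∃ (Least P)) step k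
    where
    step : ∀ k → (∀ {m} → m < k → P m → ∃ (Least P)) → P k → ∃ (Least P)
    step k rec pk with em {∃ λ m → m < k × P m}
    ... | yes (m , m<k , pm) = rec m<k pm
    ... | no ¬smaller = k , pk , λ m pm → ℕ.≮⇒≥ λ m<k → ¬smaller (m , m<k , pm)

  module _ {U : Set} (U↔ℕ : U ↔ ℕ) where
    open Generation em U↔ℕ

    size : List⁺ U → ℕ
    size xs = length (distinct xs)

    -- The sample followed by a listing of `L` is an enumeration of `L` having `xs` as a prefix.
    -- Together with `generates⇐` this replaces enumerations by finite samples.
    generates⇒ : ∀ G L {k} → GeneratesFrom G L k →
                 ∀ xs → All (members L) (toList xs) → k ≤ size xs →
                 G xs ∈ members L × G xs ∉ₗ distinct xs
    generates⇒ G L {k} gen xs@(x₀ ∷ tl) all@(x₀∈L ∷ tl⊆L) k≤ =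
      subst (λ ys → k ≤ size ys → G ys ∈ members L × G ys ∉ₗ distinct ys)
        (cong (x₀ ∷_) (applyUpTo-++ω tl rest)) (gen x (x⊆L , L⊆x) (length tl)) k≤
      where
      open Inverse U↔ℕ using (to; from; strictlyInverseʳ)

      -- Lists `U` along the bijection; `x₀`, known to lie in `L`, fills the places of strings
      -- outside `L`.
      rest : ℕ → U
      rest t with em {from t ∈ members L}
      ... | yes _ = from t
      ... | no  _ = x₀

      rest⊆L : ∀ t → rest t ∈ members L
      rest⊆L t with em {from t ∈ members L}
      ... | yes ∈L = ∈L
      ... | no  _  = x₀∈L

      rest-to : ∀ {u} → u ∈ members L → rest (to u) ≡ u
      rest-to {u} u∈L with em {from (to u) ∈ members L}
      ... | yes _  = strictlyInverseʳ u
      ... | no  ∉L = contradiction (subst (members L) (sym (strictlyInverseʳ u)) u∈L) ∉L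

      x : ℕ → U
      x = toList xs ++ω rest

      x⊆L : ∀ t → x t ∈ members L
      x⊆L = ++ω-all all rest⊆L

      L⊆x : ∀ {u} → u ∈ members L → ∃ λ t → x t ≡ u
      L⊆x {u} u∈L = length (toList xs) + to u , trans (++ω-shift (toList xs) {rest} (to u)) (rest-to u∈L)

    generates⇐ : ∀ G L {k} →
                 (∀ xs → All (members L) (toList xs) → k ≤ size xs →
                  G xs ∈ members L × G xs ∉ₗ distinct xs) →
                 GeneratesFrom G L k
    generates⇐ G L gen x (x⊆L , _) t =
      gen (prefix x t) (x⊆L 0 ∷ All.applyUpTo⁺₂ (x ∘ suc) t (x⊆L ∘ suc))

    generationTime-sound : ∀ G L {k} → generationTime G L ≡ [ k ] → GeneratesFrom G L k
    generationTime-sound G L eq with em {∃ (Least (GeneratesFrom G L))} | eq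
    ... | yes (_ , gen , _) | refl = gen

    generationTime-≤ : ∀ G L {k} → GeneratesFrom G L k → ∃ λ m → generationTime G L ≡ [ m ] × m ≤ k
    generationTime-≤ G L {k} gen with em {∃ (Least (GeneratesFrom G L))}
    ... | yes (m , _ , m-min) = m , refl , m-min k gen
    ... | no ∄least           = contradiction (least _ gen) ∄least

    infinite⇒fresh : ∀ {P : Pred U 0ℓ} → ¬ Finite P → ∀ xs → ∃ λ z → z ∈ P × z ∉ₗ xs
    infinite⇒fresh ¬fin xs = em⇒dne em λ ∄fresh →
      ¬fin (xs , λ {u} u∈P → em⇒dne em λ u∉xs → ∄fresh (u , u∈P , u∉xs))

    finite⇒size≤ : ∀ {P : Pred U 0ℓ} ((ys , _) : Finite P) →
                   ∀ xs → All P (toList xs) → size xs ≤ length ys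
    finite⇒size≤ (ys , P⊆ys) xs xs⊆P = unique-⊆⇒length≤ _≟_
      (DecUnique.deduplicate-! _≟_ (toList xs))
      (P⊆ys ∘ All.lookup xs⊆P ∘ ∈-deduplicate⁻ _≟_ (toList xs))

    -- Feasible vectors of times.

    module _ (C : Collection) where

      -- Even `z ∉ₗ distinct xs` is demanded only on behalf of an active language, so any string
      -- serves a sample at which none is active.
      Fresh : ℕ → (ℕ → ℕ) → List⁺ U → Pred U 0ℓ
      Fresh m k xs z = ∀ i → i < m → All (members (C i)) (toList xs) → k i ≤ size xs →
                       z ∈ members (C i) × z ∉ₗ distinct xs

      Feasible : ℕ → (ℕ → ℕ) → Set
      Feasible m k = ∀ xs → ∃ (Fresh m k xs)

      generates⇒feasible : ∀ {m k} G → (∀ i → i < m → GeneratesFrom G (C i) (k i)) → Feasible m k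
      generates⇒feasible G gen xs = G xs , λ i i<m → generates⇒ G (C i) (gen i i<m) xs

      -- The auxiliary P makes the induction go through: a sample contained in
      -- the last language is handled by the bound for P ∩ C m.
      closure-bound : ∀ m (P : Pred U 0ℓ) → ∃ λ b → ∀ xs → All P (toList xs) → b ≤ size xs →
        ∃ λ z → (z ∈ P × z ∉ₗ distinct xs) ×
                (∀ i → i < m → All (members (C i)) (toList xs) → z ∈ members (C i))
      closure-bound zero P with em {Finite P}
      -- One more than the length of a list covering `P`: no sample from `P` has that many distinct
      -- strings.
      ... | yes fin = suc (length (proj₁ fin)) , λ xs xs⊆P b≤ →
                      contradiction (finite⇒size≤ fin xs xs⊆P) (ℕ.<⇒≱ b≤)
      ... | no ¬fin = 0 , λ xs _ _ → map₂ (λ z-fresh → z-fresh , λ _ ()) (infinite⇒fresh ¬fin (distinct xs))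
      closure-bound (suc m) P
        with b₁ , f₁ ← closure-bound m P | b₂ , f₂ ← closure-bound m (P ∩ members (C m))
        -- The bound must be fixed before it is known whether the sample lies in `C m`, so it covers
        -- both cases.
        = b₁ ⊔ b₂ , choose
        where
        choose : ∀ xs → All P (toList xs) → b₁ ⊔ b₂ ≤ size xs →
          ∃ λ z → (z ∈ P × z ∉ₗ distinct xs) ×
                  (∀ i → i < suc m → All (members (C i)) (toList xs) → z ∈ members (C i))
        choose xs xs⊆P b≤ with em {All (members (C m)) (toList xs)}
        ... | yes xs⊆Cm with f₂ xs (All.zip (xs⊆P , xs⊆Cm)) (ℕ.m⊔n≤o⇒n≤o b₁ b₂ b≤)
        ...   | z , ((z∈P , z∈Cm) , z∉xs) , z∈C = z , (z∈P , z∉xs) , z∈C′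
          where
          z∈C′ : ∀ i → i < suc m → All (members (C i)) (toList xs) → z ∈ members (C i)
          z∈C′ i i<1+m xs⊆Ci with ℕ.m<1+n⇒m<n∨m≡n i<1+m
          ... | inj₁ i<m  = z∈C i i<m xs⊆Ci
          ... | inj₂ refl = z∈Cm
        choose xs xs⊆P b≤ | no xs⊈Cm with f₁ xs xs⊆P (ℕ.m⊔n≤o⇒m≤o b₁ b₂ b≤)
        ...   | z , z-fresh , z∈C = z , z-fresh , z∈C′
          where
          z∈C′ : ∀ i → i < suc m → All (members (C i)) (toList xs) → z ∈ members (C i)
          z∈C′ i i<1+m xs⊆Ci with ℕ.m<1+n⇒m<n∨m≡n i<1+m
          ... | inj₁ i<m  = z∈C i i<m xs⊆Ci
          ... | inj₂ refl = contradiction xs⊆Ci xs⊈Cm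

      bound : ℕ → ℕ
      bound m = proj₁ (closure-bound m (λ _ → ⊤))

      bound-fresh : ∀ m {k} xs → bound m ≤ size xs → ∃ (Fresh m k xs)
      bound-fresh m xs b≤ with proj₂ (closure-bound m (λ _ → ⊤)) xs (All.universal (λ _ → tt) _) b≤
      ... | z , (_ , z∉xs) , z∈C = z , λ i i<m xs⊆Ci _ → z∈C i i<m xs⊆Ci , z∉xs

      -- Gives the minimisation of the sum a vector to start from. Samples below the threshold
      -- activate no language, and `x₀` is then an arbitrary choice.
      feasible-bound : ∀ m → Feasible m (λ _ → bound m)
      feasible-bound m xs@(x₀ ∷ _) with bound m ℕ.≤? size xs
      ... | yes b≤ = bound-fresh m xs b≤
      ... | no  b≰ = x₀ , λ _ _ _ b≤ → contradiction b≤ b≰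

      -- From the first `n` languages to the whole collection.

      module Extension (n : ℕ) (k : ℕ → ℕ) (k-feasible : Feasible n k) where

        -- Keeping the time of C i at least i leaves only finitely many
        -- languages active on any given sample.
        time : ℕ → ℕ
        time i with i ℕ.<? n
        ... | yes _ = k i
        ... | no  _ = bound (suc i) ⊔ i

        time-< : ∀ {i} → i < n → time i ≡ k i
        time-< {i} i<n with i ℕ.<? n
        ... | yes _  = refl
        ... | no i≮n = contradiction i<n i≮n

        time-≥ : ∀ {i} → n ≤ i → time i ≡ bound (suc i) ⊔ i
        time-≥ {i} n≤i with i ℕ.<? n
        ... | yes i<n = contradiction n≤i (ℕ.<⇒≱ i<n)
        ... | no  _   = refl

        -- If the newest language has reached its time, the sample is large enough for `bound-fresh`
        -- to serve all languages so far at once. Otherwise the newest one is inactive and the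
        -- earlier witness still works.
        time-feasible : ∀ d → Feasible (d + n) time
        time-feasible zero xs with k-feasible xs
        ... | z , z-fresh = z , λ i i<n xs⊆Ci t≤ →
          z-fresh i i<n xs⊆Ci (subst (_≤ size xs) (time-< i<n) t≤)
        time-feasible (suc d) xs with time (d + n) ℕ.≤? size xs
        ... | yes t≤ = bound-fresh (suc d + n) xs
          (ℕ.m⊔n≤o⇒m≤o _ (d + n) (subst (_≤ size xs) (time-≥ (ℕ.m≤n+m n d)) t≤))
        ... | no  t≰ with time-feasible d xs
        ...   | z , z-fresh = z , z-fresh′
          where
          z-fresh′ : Fresh (suc d + n) time xs z
          z-fresh′ i i<1+m xs⊆Ci t≤ with ℕ.m<1+n⇒m<n∨m≡n i<1+m
          ... | inj₁ i<m  = z-fresh i i<m xs⊆Ci t≤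
          ... | inj₂ refl = contradiction t≤ t≰

        algorithm : Algorithm
        -- An active `i` has `i < n` or `i ≤ size xs`, hence lies below `suc (size xs) + n`.
        algorithm xs = proj₁ (time-feasible (suc (size xs)) xs)

        algorithm-generates : ∀ i → GeneratesFrom algorithm (C i) (time i)
        algorithm-generates i = generates⇐ algorithm (C i) λ xs xs⊆Ci t≤ →
          proj₂ (time-feasible (suc (size xs)) xs) i (active xs t≤) xs⊆Ci t≤
          where
          active : ∀ xs → time i ≤ size xs → i < suc (size xs) + n
          active xs t≤ with ℕ.<-≤-connex i n
          ... | inj₁ i<n = ℕ.≤-trans i<n (ℕ.m≤n+m n _)
          ... | inj₂ n≤i = ℕ.≤-trans
            (s≤s (ℕ.m⊔n≤o⇒n≤o (bound (suc i)) i (subst (_≤ size xs) (time-≥ n≤i) t≤)))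
            (ℕ.m≤m+n (suc (size xs)) n)

        algorithm-≤ : ∀ {i} → i < n → ∃ λ m → generationTime algorithm (C i) ≡ [ m ] × m ≤ k i
        algorithm-≤ {i} i<n =
          generationTime-≤ algorithm (C i)
            (subst (GeneratesFrom algorithm (C i)) (time-< i<n) (algorithm-generates i))

      -- Turns the choice of a minimal vector into a least-number problem on ℕ.
      Cost : ℕ → Pred ℕ 0ℓ
      Cost n s = ∃ λ k → Feasible n k × sum (applyUpTo k n) ≡ s

-- Extended times and Pareto optimality.

toℕ : ℕ∞ → ℕ
toℕ [ k ] = k
-- A placeholder: at each index below `n` the time of the competitor `G` is shown finite before its
-- value matters.
toℕ ⊤⁺    = 0

≮∞⇒≤ : ∀ {a b m k} → a ≡ [ m ] → m ≤ k → ¬ (a <∞ b) → b ≡ [ toℕ b ] × toℕ b ≤ k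
≮∞⇒≤ {b = [ _ ]} refl m≤k a≮b = refl , ℕ.≤-trans (ℕ.≮⇒≥ (a≮b ∘ ∞.[_])) m≤k
≮∞⇒≤ {b = ⊤⁺}    refl m≤k a≮b = contradiction ∞.[ _ ]<⊤⁺ a≮b

<∞⇒< : ∀ {a b m k} → a ≡ [ m ] → m ≤ k → b <∞ a → b ≡ [ toℕ b ] × toℕ b < k
<∞⇒< refl m≤k ∞.[ b<m ] = refl , ℕ.<-≤-trans b<m m≤k

mainTheorem1 : (em : ExcludedMiddle 0ℓ) {U : Set} (U↔ℕ : U ↔ ℕ) →
    let open Generation em U↔ℕ in
    (C : Collection) (n : ℕ) →
    ∃ λ (A : Algorithm) →
    NonUniformlyGenerates A C ×
    (∀ (G : Algorithm) (i : ℕ) → i < n →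
    generationTime G (C i) <∞ generationTime A (C i) →
    ∃ λ (j : ℕ) → j < n × j ≢ i ×
    generationTime A (C j) <∞ generationTime G (C j))
mainTheorem1 em U↔ℕ C n
  with _ , (k , k-feasible , refl) , k-min ←
       least em (Cost em U↔ℕ C n) (_ , feasible-bound em U↔ℕ C n , refl)
  = algorithm , (λ i → time i , algorithm-generates i) , optimal
  where
  open Generation em U↔ℕ
  open Extension em U↔ℕ C n k k-feasible

  optimal : ∀ G i → i < n → generationTime G (C i) <∞ generationTime algorithm (C i) →
            ∃ λ j → j < n × j ≢ i × generationTime algorithm (C j) <∞ generationTime G (C j)
  optimal G i i<n G<A = em⇒dne em λ ∄worse →
    let
      tG : ℕ → ℕ
      tG j = toℕ (generationTime G (C j))

      tG-i : generationTime G (C i) ≡ [ tG i ] × tG i < k i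
      tG-i = let _ , eq , m≤k = algorithm-≤ i<n in <∞⇒< eq m≤k G<A

      tG-≤ : ∀ j → j < n → generationTime G (C j) ≡ [ tG j ] × tG j ≤ k j
      -- At `i` the assumed improvement gives the bound; elsewhere `∄worse` does, which also
      -- excludes an infinite time.
      tG-≤ j j<n = case j ℕ.≟ i of λ where
        (yes refl) → map₂ ℕ.<⇒≤ tG-i
        (no j≢i)   → let _ , eq , m≤k = algorithm-≤ j<n in
                     ≮∞⇒≤ eq m≤k λ A<G → ∄worse (j , j<n , j≢i , A<G)

      tG-feasible : Feasible em U↔ℕ C n tG
      tG-feasible = generates⇒feasible em U↔ℕ C G λ j j<n →
        generationTime-sound em U↔ℕ G (C j) (proj₁ (tG-≤ j j<n))
    in
    -- `tG` would be a feasible vector of smaller sum than `k`, strictly so because of index `i`.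
    contradiction (k-min _ (tG , tG-feasible , refl))
      (ℕ.<⇒≱ (sum-mono-< n (λ j j<n → proj₂ (tG-≤ j j<n)) i<n (proj₂ tG-i)))
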